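{- Let $P$ be a partially ordered pattern (a partial order on $\{1,\ldots,k\}$). The permutation class $\operatorname{Av}(P)$ has a regular insertion encoding if and only if $P$ is bipartite, i.e. $P$ has height at most $2$ (it contains no chain $a<_P b<_P c$ of three elements).
   Context: A permutation $\pi$ of size $n$ contains the POP $P$ if there are indices $i_1<i_2<\cdots<i_k$ such that $\pi(i_a)<\pi(i_b)$ whenever $a<_P b$; $\operatorname{Av}(P)$ is the set of all permutations (of all sizes) avoiding $P$. Insertion encoding: a permutation of size $n$ is built by inserting the values $1,2,\ldots,n$ in increasing order into a configuration, a word over the symbols $\bullet$ (placed entry) and $\diamond$ (slot), starting from the single slot $\diamond$. At step $j$ the value $j$ is inserted into the $i$-th slot from the left by one of four operations: $f_i$ replaces that slot by $\bullet$, $l_i$ by $\bullet\diamond$, $r_i$ by $\diamond\bullet$, $m_i$ by $\diamond\bullet\diamond$; after $n$ steps no slots remain and the left-to-right sequence of inserted values is the permutation. Every permutation has a unique such encoding as a word over the letters $\{f_i,l_i,r_i,m_i : i\ge 1\}$. A permutation class has a regular insertion encoding if the set of encodings of its members is a regular language over a finite alphabet (in particular only finitely many letters occur). -}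

module Defs where

open import Data.Nat using (ℕ; zero; suc; _<_)
open import Data.Fin using (Fin; toℕ)
open import Data.Bool using (Bool; true; false; T)
open import Data.List using (List; []; _∷_; length; lookup; map; upTo)
open import Data.Maybe using (Maybe; just; nothing)
open import Data.Product using (Σ; _×_; _,_; ∃-syntax)
open import Data.Empty using (⊥)
open import Relation.Nullary using (¬_)
open import Relation.Binary.PropositionalEquality using (_≡_)
open import Data.List.Relation.Binary.Permutation.Propositional using (_↭_)

record POP (k : ℕ) : Set where
  field
    lt      : Fin k → Fin k → Bool
    irrefl  : ∀ a → ¬ T (lt a a)
    trans   : ∀ a b c → T (lt a b) → T (lt b c) → T (lt a c)
open POP public

Bipartite : ∀ {k} → POP k → Set
Bipartite {k} P = ¬ (Σ (Fin k) λ a → Σ (Fin k) λ b → Σ (Fin k) λ c →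
                       T (lt P a b) × T (lt P b c))

oneTo : ℕ → List ℕ
oneTo n = map suc (upTo n)

IsPerm : List ℕ → Set
IsPerm π = π ↭ oneTo (length π)

Contains : ∀ {k} → List ℕ → POP k → Set
Contains {k} π P =
  Σ (Fin k → Fin (length π)) λ ι →
    (∀ a b → toℕ a < toℕ b → toℕ (ι a) < toℕ (ι b)) ×
    (∀ a b → T (lt P a b) → lookup π (ι a) < lookup π (ι b))

Avoids : ∀ {k} → List ℕ → POP k → Set
Avoids π P = ¬ Contains π P

InAv : ∀ {k} → POP k → List ℕ → Set
InAv P π = IsPerm π × Avoids π P

data Op : Set where
  f l r m : Op

-- The letter o_i (i ≥ 1) is represented as (o , i - 1): the ℕ component
-- is the 0-based index of the slot (counted from the left).
Letter : Set
Letter = Op × ℕ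

data Cell : Set where
  dot  : ℕ → Cell     -- a placed entry •, remembering its value
  slot : Cell

replacement : Op → ℕ → List Cell
replacement f v = dot v ∷ []
replacement l v = dot v ∷ slot ∷ []
replacement r v = slot ∷ dot v ∷ []
replacement m v = slot ∷ dot v ∷ slot ∷ []

_++c_ : List Cell → List Cell → List Cell
[] ++c ys = ys
(x ∷ xs) ++c ys = x ∷ (xs ++c ys)

insert : Op → ℕ → ℕ → List Cell → Maybe (List Cell)
insert o v i [] = nothing
insert o v i (dot x ∷ c) with insert o v i c
... | just c' = just (dot x ∷ c')
... | nothing = nothing
insert o v zero (slot ∷ c) = just (replacement o v ++c c)
insert o v (suc i) (slot ∷ c) with insert o v i c
... | just c' = just (slot ∷ c')
... | nothing = nothing

run : ℕ → List Letter → List Cell → Maybe (List Cell)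
run v [] c = just c
run v ((o , i) ∷ w) c with insert o v i c
... | just c' = run (suc v) w c'
... | nothing = nothing

values : List Cell → Maybe (List ℕ)
values [] = just []
values (slot ∷ _) = nothing
values (dot v ∷ c) with values c
... | just vs = just (v ∷ vs)
... | nothing = nothing

decode : List Letter → Maybe (List ℕ)
decode w with run 1 w (slot ∷ [])
... | just c = values c
... | nothing = nothing

Encodes : List Letter → List ℕ → Set
Encodes w π = decode w ≡ just π

EncLang : ∀ {k} → POP k → List Letter → Set
EncLang P w = ∃[ π ] (InAv P π × Encodes w π)

embedLetter : ∀ {b} → Op × Fin b → Letter
embedLetter (o , j) = (o , toℕ j)

record DFA (b : ℕ) : Set where
  field
    states    : ℕ
    start     : Fin states
    accepting : Fin states → Bool
    δ         : Fin states → Op × Fin b → Fin states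
open DFA public

runDFA : ∀ {b} (A : DFA b) → Fin (states A) → List (Op × Fin b) → Fin (states A)
runDFA A q [] = q
runDFA A q (a ∷ w) = runDFA A (δ A q a) w

Accepts : ∀ {b} → DFA b → List (Op × Fin b) → Set
Accepts A w = T (accepting A (runDFA A (start A) w))

-- L ⊆ words over the letters {o_i} is regular (over a finite alphabet):
-- some finite alphabet A_b contains all letters occurring in L, and a
-- DFA over A_b recognises exactly L.
Regular : (List Letter → Set) → Set
Regular L = Σ ℕ λ b → Σ (DFA b) λ A →
  ∀ w → (L w → Σ (List (Op × Fin b)) λ w' → map embedLetter w' ≡ w × Accepts A w')
      × (∀ w' → map embedLetter w' ≡ w → Accepts A w' → L w)

RegularInsertionEncoding : ∀ {k} → POP k → Set
RegularInsertionEncoding P = Regular (EncLang P)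

{-# OPTIONS --safe #-}
-- If P contains a chain of three elements, then for every n and every choice
-- of two directions consider a permutation whose values ≤ n are monotone, whose
-- values > n are monotone, and in which the two ranges alternate, so that n + 1
-- slots are open once the small values are placed.  Among values x < y < z
-- either x, y are both small or y, z are both large, so the directions can be
-- chosen to exclude the chain.  The number of open slots determines which
-- continuations close them all, so no automaton with finitely many states can
-- recognise the encodings.
--
-- If P is bipartite of size k, a configuration with more than k slots forces an
-- occurrence of P: its non-maximal elements go to entries already placed, its
-- maximal ones to entries that will fill the slots.  So at most k + 1 slots
-- need be considered, and a partial occurrence is determined, as far as its
-- extensions are concerned, by the word formed by the slots and the elements
-- placed so far.  These words are finitely many, and the set of those that
-- occur in the current configuration is the state of an automaton.

module Submission where

open import Defs
open import Data.Nat using (ℕ; zero; suc; _+_; _^_; _≤_; _<_; _≤?_; _<?_; z≤n; s≤s; s≤s⁻¹; z<s)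
import Data.Nat.Properties as ℕₚ
open import Data.Bool using (Bool; true; false; T)
open import Data.Bool.Properties using (T?)
open import Data.Fin as Fin using (Fin; toℕ; fromℕ<; finToFun; funToFin) renaming (zero to fzero; suc to fsuc)
import Data.Fin.Properties as Finₚ
open import Data.List using (List; []; _∷_; [_]; _++_; length; map; lookup; catMaybes; upTo; allFin; tabulate; concatMap)
import Data.List.Properties as Listₚ
open import Data.List.Membership.Propositional using (_∈_; _∉_)
import Data.List.Membership.Propositional.Properties as ∈ₚ
open import Data.List.Membership.DecPropositional using () renaming (_∈?_ to mem?)
open import Data.List.Relation.Unary.All as All using (All; []; _∷_)
import Data.List.Relation.Unary.All.Properties as Allₚ
open import Data.List.Relation.Unary.Any as Any using (here; there)
open import Data.List.Relation.Unary.AllPairs as AllPairs using (AllPairs; []; _∷_)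
import Data.List.Relation.Unary.Any.Properties as Anyₚ
import Data.List.Relation.Unary.AllPairs.Properties as AllPairsₚ
open import Data.List.Relation.Binary.Sublist.Heterogeneous using (Sublist; []; _∷_; _∷ʳ_; minimum)
import Data.List.Relation.Binary.Sublist.Heterogeneous.Properties as Sublistₚ
open import Data.List.Relation.Binary.Permutation.Propositional as ↭ using (_↭_; ↭-reflexive; ↭-sym; ↭-trans; prep)
import Data.List.Relation.Binary.Permutation.Propositional.Properties as ↭ₚ
open import Data.Maybe using (Maybe; just; nothing)
import Data.Maybe.Properties as Maybeₚ
open import Data.Maybe.Relation.Unary.All as MaybeAll using (just; nothing)
open import Data.Product using (Σ; _×_; ∃₂; ∃-syntax; _,_; proj₁; proj₂)
open import Data.Sum using (_⊎_; inj₁; inj₂; [_,_]′)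
open import Data.Empty using (⊥-elim)
open import Function using (_∘_; id)
open import Relation.Nullary using (¬_; Dec; yes; no; contradiction; ⌊_⌋)
open import Relation.Nullary.Decidable using (_×-dec_; _→-dec_; _⊎-dec_; ¬?; map′; toWitness; fromWitness)
open import Relation.Binary.Definitions using (DecidableEquality; tri<; tri≈; tri>)
open import Relation.Binary.PropositionalEquality as ≡ using (_≡_; _≢_; refl; sym; cong; cong₂; subst)

-- A slot ⋄ is nothing, a placed entry x is just x.
Conf : Set → Set
Conf A = List (Maybe A)

holes : {A : Set} → Conf A → ℕ
holes []             = 0
holes (nothing ∷ c) = suc (holes c)
holes (just _  ∷ c) = holes c

holes-++ : {A : Set} (c d : Conf A) → holes (c ++ d) ≡ holes c + holes d
holes-++ []             d = refl
holes-++ (nothing ∷ c) d = cong suc (holes-++ c d)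
holes-++ (just _  ∷ c) d = holes-++ c d

holes-map-just : {A : Set} (xs : List A) → holes (map just xs) ≡ 0
holes-map-just []       = refl
holes-map-just (_ ∷ xs) = holes-map-just xs

length≡holes+entries : {A : Set} (c : Conf A) → length c ≡ holes c + length (catMaybes c)
length≡holes+entries []             = refl
length≡holes+entries (nothing ∷ c) = cong suc (length≡holes+entries c)
length≡holes+entries (just _  ∷ c) =
  ≡.trans (cong suc (length≡holes+entries c)) (sym (ℕₚ.+-suc (holes c) _))

-- frame o (just x) is the block that replaces a slot when x is inserted by
-- the operation o; frame o nothing is the same block with x left out.
frame : {A : Set} → Op → Maybe A → Conf A
frame f e = map just (catMaybes [ e ])
frame l e = map just (catMaybes [ e ]) ++ [ nothing ]
frame r e = nothing ∷ map just (catMaybes [ e ])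
frame m e = nothing ∷ map just (catMaybes [ e ]) ++ [ nothing ]

-- Kept generic in the entries and in the block, so that one relation serves both the insertion of a
-- value into a configuration and the parallel move on words of pattern elements, where the new
-- entry may be dropped. As a relation it can also be read backwards.
data Plug {A : Set} (b : Conf A) : ℕ → Conf A → Conf A → Set where
  here  : ∀ {c} → Plug b 0 (nothing ∷ c) (b ++ c)
  hole  : ∀ {i c d} → Plug b i c d → Plug b (suc i) (nothing ∷ c) (nothing ∷ d)
  entry : ∀ {i x c d} → Plug b i c d → Plug b i (just x ∷ c) (just x ∷ d)

plug : {A : Set} (b : Conf A) {i : ℕ} (c : Conf A) → i < holes c → ∃[ d ] Plug b i c d
plug b {zero}  (nothing ∷ c) _  = _ , here
plug b {suc i} (nothing ∷ c) lt = let d , p = plug b c (s≤s⁻¹ lt) in _ , hole p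
plug b         (just x ∷ c)  lt = let d , p = plug b c lt in _ , entry p

plug-< : {A : Set} {b : Conf A} {i : ℕ} {c d : Conf A} → Plug b i c d → i < holes c
plug-< here      = z<s
plug-< (hole p)  = s≤s (plug-< p)
plug-< (entry p) = plug-< p

plug? : {A : Set} → DecidableEquality (Conf A) → ∀ (b : Conf A) i c d → Dec (Plug b i c d)
plug? _≟_ b i [] d = no λ ()
plug? _≟_ b zero (nothing ∷ c) d with (b ++ c) ≟ d
... | yes refl = yes here
... | no neq   = no λ { here → neq refl }
plug? _≟_ b (suc i) (nothing ∷ c) []            = no λ ()
plug? _≟_ b (suc i) (nothing ∷ c) (just _ ∷ d)  = no λ ()
plug? _≟_ b (suc i) (nothing ∷ c) (nothing ∷ d) =
  map′ hole (λ { (hole p) → p }) (plug? _≟_ b i c d)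
plug? _≟_ b i (just x ∷ c) []            = no λ ()
plug? _≟_ b i (just x ∷ c) (nothing ∷ d) = no λ ()
plug? _≟_ b i (just x ∷ c) (just y ∷ d) with [ just x ] ≟ [ just y ]
... | no neq   = no λ { (entry _) → neq refl }
... | yes refl = map′ entry (λ { (entry p) → p }) (plug? _≟_ b i c d)

-- Effect of an insertion on slots and entries

newSlots : Op → ℕ
newSlots f = 0
newSlots l = 1
newSlots r = 1
newSlots m = 2

holes-frame : {A : Set} (o : Op) (e : Maybe A) → holes (frame o e) ≡ newSlots o
holes-frame f nothing  = refl
holes-frame l nothing  = refl
holes-frame r nothing  = refl
holes-frame m nothing  = refl
holes-frame f (just x) = refl
holes-frame l (just x) = refl
holes-frame r (just x) = refl
holes-frame m (just x) = refl

-- The filled slot is counted on the left, which avoids subtraction. The change depends on `o` alone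
-- and not on `e`, so slot counts can be compared along any two runs of the same word.
plug-holes : {A : Set} {o : Op} {e : Maybe A} {i : ℕ} {c d : Conf A} →
             Plug (frame o e) i c d → suc (holes d) ≡ newSlots o + holes c
plug-holes {o = o} {e} (here {c}) =
  ≡.trans (cong suc (≡.trans (holes-++ (frame o e) c) (cong (_+ holes c) (holes-frame o e))))
          (sym (ℕₚ.+-suc (newSlots o) (holes c)))
plug-holes {o = o} (hole {c = c} p) =
  ≡.trans (cong suc (plug-holes {o = o} p)) (sym (ℕₚ.+-suc (newSlots o) (holes c)))
plug-holes {o = o} (entry p) = plug-holes {o = o} p

entries-frame : {A : Set} (o : Op) (e : Maybe A) → catMaybes (frame o e) ≡ catMaybes [ e ]
entries-frame f nothing  = refl
entries-frame l nothing  = refl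
entries-frame r nothing  = refl
entries-frame m nothing  = refl
entries-frame f (just x) = refl
entries-frame l (just x) = refl
entries-frame r (just x) = refl
entries-frame m (just x) = refl

plug-entries : {A : Set} {o : Op} {e : Maybe A} {i : ℕ} {c d : Conf A} →
               Plug (frame o e) i c d →
               ∃₂ λ xs ys → catMaybes c ≡ xs ++ ys × catMaybes d ≡ xs ++ catMaybes [ e ] ++ ys
plug-entries {o = o} {e} (here {c}) = [] , _ , refl ,
  ≡.trans (Listₚ.catMaybes-++ (frame o e) c) (cong (_++ catMaybes c) (entries-frame o e))
plug-entries {o = o} (hole p) = plug-entries {o = o} p
plug-entries {o = o} (entry {x = x} p) with xs , ys , p₁ , p₂ ← plug-entries {o = o} p =
  x ∷ xs , ys , cong (x ∷_) p₁ , cong (x ∷_) p₂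

plug-entries-↭ : {A : Set} {o : Op} {x : A} {i : ℕ} {c d : Conf A} →
                 Plug (frame o (just x)) i c d → catMaybes d ↭ x ∷ catMaybes c
plug-entries-↭ {o = o} {x} p with xs , ys , p₁ , p₂ ← plug-entries {o = o} p
  rewrite p₁ | p₂ = ↭ₚ.shift x xs ys

plug-entries-≡ : {A : Set} {o : Op} {i : ℕ} {c d : Conf A} →
                 Plug (frame o nothing) i c d → catMaybes d ≡ catMaybes c
plug-entries-≡ {o = o} p with xs , ys , p₁ , p₂ ← plug-entries {o = o} p =
  ≡.trans p₂ (sym p₁)

-- Runs of the insertion encoding

data Run : ℕ → List Letter → Conf ℕ → Conf ℕ → Set where
  []  : ∀ {v c} → Run v [] c c
  _∷_ : ∀ {v o i w c d e} → Plug (frame o (just v)) i c d → Run (suc v) w d e →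
        Run v ((o , i) ∷ w) c e

mark : Cell → Maybe ℕ
mark (dot x) = just x
mark slot    = nothing

map-mark-replacement : ∀ o v c → map mark (replacement o v ++c c) ≡ frame o (just v) ++ map mark c
map-mark-replacement f v c = refl
map-mark-replacement l v c = refl
map-mark-replacement r v c = refl
map-mark-replacement m v c = refl

insert⇒plug : ∀ o v i c {d} → insert o v i c ≡ just d →
              Plug (frame o (just v)) i (map mark c) (map mark d)
insert⇒plug o v i (dot x ∷ c) eq with insert o v i c in eq′
insert⇒plug o v i (dot x ∷ c) refl | just d = entry (insert⇒plug o v i c eq′)
insert⇒plug o v zero (slot ∷ c) refl
  rewrite map-mark-replacement o v c = here
insert⇒plug o v (suc i) (slot ∷ c) eq with insert o v i c in eq′
insert⇒plug o v (suc i) (slot ∷ c) refl | just d = hole (insert⇒plug o v i c eq′)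

plug⇒insert : ∀ o v i c {d} → Plug (frame o (just v)) i (map mark c) d →
              ∃[ d′ ] (insert o v i c ≡ just d′ × map mark d′ ≡ d)
plug⇒insert o v i (dot x ∷ c) (entry p)
  with d′ , eq , refl ← plug⇒insert o v i c p rewrite eq = _ , refl , refl
plug⇒insert o v zero (slot ∷ c) here = _ , refl , map-mark-replacement o v c
plug⇒insert o v (suc i) (slot ∷ c) (hole p)
  with d′ , eq , refl ← plug⇒insert o v i c p rewrite eq = _ , refl , refl

run⇒Run : ∀ v w c {d} → run v w c ≡ just d → Run v w (map mark c) (map mark d)
run⇒Run v []            c refl = []
run⇒Run v ((o , i) ∷ w) c eq with insert o v i c in eq′
... | just d = insert⇒plug o v i c eq′ ∷ run⇒Run (suc v) w d eq

Run⇒run : ∀ v w c {d} → Run v w (map mark c) d → ∃[ d′ ] (run v w c ≡ just d′ × map mark d′ ≡ d)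
Run⇒run v []            c [] = c , refl , refl
Run⇒run v ((o , i) ∷ w) c (p ∷ ρ)
  with d , eq , refl ← plug⇒insert o v i c p rewrite eq = Run⇒run (suc v) w d ρ

values⇒mark : ∀ c {π} → values c ≡ just π → map mark c ≡ map just π
values⇒mark []          refl = refl
values⇒mark (dot x ∷ c) eq with values c in eq′
values⇒mark (dot x ∷ c) refl | just π = cong (just x ∷_) (values⇒mark c eq′)

mark⇒values : ∀ c π → map mark c ≡ map just π → values c ≡ just π
mark⇒values []          []      eq = refl
mark⇒values (dot x ∷ c) (y ∷ π) eq
  rewrite mark⇒values c π (Listₚ.∷-injectiveʳ eq)
        | Maybeₚ.just-injective (Listₚ.∷-injectiveˡ eq) = refl
mark⇒values []          (_ ∷ _) ()
mark⇒values (dot _ ∷ _) []      ()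
mark⇒values (slot ∷ _)  []      ()
mark⇒values (slot ∷ _)  (_ ∷ _) ()

encodes⇒Run : ∀ {w π} → Encodes w π → Run 1 w [ nothing ] (map just π)
encodes⇒Run {w} eq with run 1 w (slot ∷ []) in eq′
... | just d = subst (Run 1 w _) (values⇒mark d eq) (run⇒Run 1 w (slot ∷ []) eq′)

Run⇒encodes : ∀ {w π} → Run 1 w [ nothing ] (map just π) → Encodes w π
Run⇒encodes {w} {π} ρ with d , eq , p ← Run⇒run 1 w (slot ∷ []) ρ rewrite eq = mark⇒values d π p

-- Slots are never adjacent: each is followed by a placed entry unless it ends the configuration.
-- These entries later host the non-maximal elements of a bipartite pattern.
data Alternating : Conf ℕ → Set where
  []    : Alternating []
  entry : ∀ {x c} → Alternating c → Alternating (just x ∷ c)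
  last  : Alternating [ nothing ]
  hole  : ∀ {x c} → Alternating c → Alternating (nothing ∷ just x ∷ c)

plug-alternating : ∀ {o v i c d} → Plug (frame o (just v)) i c d → Alternating c → Alternating d
plug-alternating {f} here last = entry []
plug-alternating {l} here last = entry last
plug-alternating {r} here last = hole []
plug-alternating {m} here last = hole last
plug-alternating {f} here (hole a) = entry (entry a)
plug-alternating {l} here (hole a) = entry (hole a)
plug-alternating {r} here (hole a) = hole (entry a)
plug-alternating {m} here (hole a) = hole (hole a)
plug-alternating {o} (hole (entry p)) (hole a) = hole (plug-alternating {o} p a)
plug-alternating {o} (entry p) (entry a) = entry (plug-alternating {o} p a)

oneTo-suc : ∀ n → suc n ∷ oneTo n ↭ oneTo (suc n)
oneTo-suc n = ↭-trans (↭ₚ.∷↭∷ʳ (suc n) (oneTo n))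
  (↭-reflexive (≡.trans (sym (Listₚ.map-++ suc (upTo n) [ n ])) (cong (map suc) (Listₚ.upTo-∷ʳ n))))

oneTo-< : ∀ n → All (_< suc n) (oneTo n)
oneTo-< n = Allₚ.map⁺ (Allₚ.applyUpTo⁺₁ id n s≤s)

record Stage (n : ℕ) (c : Conf ℕ) : Set where
  constructor stage
  field
    placed      : catMaybes c ↭ oneTo n
    alternating : Alternating c

  below : All (_< suc n) (catMaybes c)
  below = ↭ₚ.All-resp-↭ (↭-sym placed) (oneTo-< n)

stage₀ : Stage 0 [ nothing ]
stage₀ = stage ↭.refl last

plug-stage : ∀ {o n i c d} → Plug (frame o (just (suc n))) i c d → Stage n c → Stage (suc n) d
plug-stage {o} {n} p (stage pl a) = stage
  (↭-trans (plug-entries-↭ {o = o} p) (↭-trans (prep _ pl) (oneTo-suc n)))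
  (plug-alternating {o} p a)

catMaybes-map-just : {A : Set} (xs : List A) → catMaybes (map just xs) ≡ xs
catMaybes-map-just = Listₚ.mapMaybe-just

-- A word that decodes at all decodes to a permutation, so an automaton has to test only that every
-- slot gets closed and that the pattern is avoided.
run-isPerm : ∀ {n w c π} → Stage n c → Run (suc n) w c (map just π) → IsPerm π
run-isPerm {n} {π = π} (stage pl _) [] = subst (λ k → π ↭ oneTo k) (sym len) pl′
  where
  pl′ : π ↭ oneTo n
  pl′ = subst (_↭ oneTo n) (catMaybes-map-just π) pl
  len : length π ≡ n
  len = ≡.trans (↭ₚ.↭-length pl′) (≡.trans (Listₚ.length-map suc (upTo n)) (Listₚ.length-upTo n))
run-isPerm st (_∷_ {o = o} p ρ) = run-isPerm (plug-stage {o} p st) ρ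

-- Chains of length three

lookup-AllPairs : {A : Set} {R : A → A → Set} {xs : List A} → AllPairs R xs →
                  ∀ i j → toℕ i < toℕ j → R (lookup xs i) (lookup xs j)
lookup-AllPairs {xs = x ∷ xs} (ps ∷ _) fzero (fsuc j) _ = All.lookup ps (∈ₚ.∈-lookup j)
lookup-AllPairs {xs = x ∷ xs} (_ ∷ ps) (fsuc i) (fsuc j) i<j = lookup-AllPairs ps i j (s≤s⁻¹ i<j)

Monotone : Bool → ℕ → ℕ → Set
Monotone true  x y = x < y
Monotone false x y = y < x

-- Meant for `x` standing to the left of `y`. Pairs with one value on each side of the threshold `t`
-- are unconstrained, which is what lets the two ranges interleave.
Bimonotone : ℕ → Bool → Bool → ℕ → ℕ → Set
Bimonotone t d₁ d₂ x y = (x ≤ t → y ≤ t → Monotone d₁ x y) × (t < x → t < y → Monotone d₂ x y)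

-- The direction is chosen against the pattern: if `b` lies left of `a`, the two form a descent,
-- which an increasing range excludes; otherwise they form an ascent, which a decreasing range
-- excludes.
not-against : ∀ {k} (a b : Fin k) {x y} → a ≢ b → x < y →
              let d = ⌊ toℕ b <? toℕ a ⌋ in
              (toℕ a < toℕ b → Monotone d x y) → ¬ (toℕ b < toℕ a → Monotone d y x)
not-against a b a≢b x<y ab ba with toℕ b <? toℕ a
... | yes b<a = ℕₚ.<-asym x<y (ba b<a)
... | no  b≮a = ℕₚ.<-asym x<y (ab (ℕₚ.≤∧≢⇒< (ℕₚ.≮⇒≥ b≮a) (a≢b ∘ Finₚ.toℕ-injective)))

lt⇒≢ : ∀ {k} (P : POP k) {a b} → T (lt P a b) → a ≢ b
lt⇒≢ P a<b refl = irrefl P _ a<b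

avoids-chain : ∀ {k} (P : POP k) {a b c} → T (lt P a b) → T (lt P b c) → ∀ t {π} →
               AllPairs (Bimonotone t ⌊ toℕ b <? toℕ a ⌋ ⌊ toℕ c <? toℕ b ⌋) π → Avoids π P
avoids-chain P {a} {b} {c} a<b b<c t {π} ps (ι , mono , vals) with lookup π (ι b) ≤? t
... | yes y≤t = not-against a b (lt⇒≢ P a<b) (vals a b a<b)
                  (λ lt → proj₁ (rel a b lt) x≤t y≤t)
                  (λ lt → proj₁ (rel b a lt) y≤t x≤t)
  where
  rel : ∀ p q → toℕ p < toℕ q → Bimonotone t _ _ (lookup π (ι p)) (lookup π (ι q))
  rel p q lt = lookup-AllPairs ps (ι p) (ι q) (mono p q lt)
  x≤t : lookup π (ι a) ≤ t
  x≤t = ℕₚ.≤-trans (ℕₚ.<⇒≤ (vals a b a<b)) y≤t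
... | no y≰t = not-against b c (lt⇒≢ P b<c) (vals b c b<c)
                 (λ lt → proj₂ (rel b c lt) t<y t<z)
                 (λ lt → proj₂ (rel c b lt) t<z t<y)
  where
  rel : ∀ p q → toℕ p < toℕ q → Bimonotone t _ _ (lookup π (ι p)) (lookup π (ι q))
  rel p q lt = lookup-AllPairs ps (ι p) (ι q) (mono p q lt)
  t<y : t < lookup π (ι b)
  t<y = ℕₚ.≰⇒> y≰t
  t<z : t < lookup π (ι c)
  t<z = ℕₚ.<-trans t<y (vals b c b<c)

-- Avoiders whose encodings pass through many slots

nextSlot : Letter → Letter
nextSlot (o , i) = o , suc i

run-entry : ∀ {v w x c d} → Run v w c d → Run v w (just x ∷ c) (just x ∷ d)
run-entry []      = []
run-entry (_∷_ {o = o} p ρ) = _∷_ {o = o} (entry p) (run-entry ρ)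

run-hole : ∀ {v w c d} → Run v w c d → Run v (map nextSlot w) (nothing ∷ c) (nothing ∷ d)
run-hole []      = []
run-hole (_∷_ {o = o} p ρ) = _∷_ {o = o} (hole p) (run-hole ρ)

run-cast : ∀ {v v′ w c d} → v ≡ v′ → Run v w c d → Run v′ w c d
run-cast refl ρ = ρ

run-++ : ∀ {v w w′ c d e} → Run v w c d → Run (length w + v) w′ d e → Run v (w ++ w′) c e
run-++ [] ρ = ρ
run-++ {v} {w = _ ∷ w} (_∷_ {o = o} p ρ) ρ′ = _∷_ {o = o} p
  (run-++ ρ (run-cast (sym (ℕₚ.+-suc (length w) v)) ρ′))

run-split : ∀ {v} w {w′ c e} → Run v (w ++ w′) c e →
            ∃[ d ] (Run v w c d × Run (length w + v) w′ d e)
run-split []      ρ = _ , [] , ρ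
run-split {v} (_ ∷ w) (_∷_ {o = o} p ρ) with d , ρ₁ , ρ₂ ← run-split w ρ =
  d , _∷_ {o = o} p ρ₁ , run-cast (ℕₚ.+-suc (length w) v) ρ₂

run-holes : ∀ {v v′ w c c′ d d′} → Run v w c d → Run v′ w c′ d′ → holes c ≡ holes c′ → holes d ≡ holes d′
run-holes [] [] eq = eq
run-holes (_∷_ {o = o} p ρ) (p′ ∷ ρ′) eq = run-holes ρ ρ′ (ℕₚ.suc-injective
  (≡.trans (plug-holes {o = o} p) (≡.trans (cong (newSlots o +_) eq) (sym (plug-holes {o = o} p′)))))

-- Every letter changes the slot count by a fixed amount, so a word that closes all slots determines
-- how many were open before it.
run-holes⁻ : ∀ {v v′ w c c′ d d′} → Run v w c d → Run v′ w c′ d′ → holes d ≡ holes d′ → holes c ≡ holes c′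
run-holes⁻ [] [] eq = eq
run-holes⁻ (_∷_ {o = o} p ρ) (p′ ∷ ρ′) eq = ℕₚ.+-cancelˡ-≡ (newSlots o) _ _
  (≡.trans (sym (plug-holes {o = o} p))
    (≡.trans (cong suc (run-holes⁻ ρ ρ′ eq)) (plug-holes {o = o} p′)))

placeSmallIncreasing : ∀ n v → ∃₂ λ w c → Run v w [ nothing ] c × length w ≡ n × holes c ≡ suc n ×
                       All (v ≤_) (catMaybes c) × AllPairs _<_ (catMaybes c)
placeSmallIncreasing zero    v = [] , _ , [] , refl , refl , [] , []
placeSmallIncreasing (suc n) v
  with w , c , ρ , len , hs , ≥v , inc ← placeSmallIncreasing n (suc v) =
  -- The smallest value splits the slot in two; the larger ones are all placed in the right half,
  -- hence the shift of `w`.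
  (m , 0) ∷ map nextSlot w , nothing ∷ just v ∷ c ,
  _∷_ {o = m} here (run-hole (run-entry ρ)) ,
  cong suc (≡.trans (Listₚ.length-map nextSlot w) len) , cong suc hs ,
  ℕₚ.≤-refl ∷ All.map ℕₚ.<⇒≤ ≥v , ≥v ∷ inc

placeSmallDecreasing : ∀ n → ∃₂ λ w c → Run 1 w [ nothing ] (nothing ∷ c) × length w ≡ n × holes c ≡ n ×
                       All (_≤ n) (catMaybes c) × AllPairs (Monotone false) (catMaybes c)
placeSmallDecreasing zero    = [] , _ , [] , refl , refl , [] , []
placeSmallDecreasing (suc n)
  with w , c , ρ , refl , hs , ≤n , dec ← placeSmallDecreasing n =
  -- The last value is the largest and has to stand first, so it goes into the leading slot, which
  -- the statement keeps explicit.
  w ++ [ m , 0 ] , just (length w + 1) ∷ nothing ∷ c ,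
  run-++ ρ (_∷_ {o = m} here []) ,
  ≡.trans (Listₚ.length-++-sucʳ w (m , 0) []) (cong (suc ∘ length) (Listₚ.++-identityʳ w)) ,
  cong suc hs ,
  ℕₚ.≤-reflexive (ℕₚ.+-comm (length w) 1) ∷ All.map ℕₚ.m≤n⇒m≤1+n ≤n ,
  All.map (λ p → ℕₚ.≤-trans (s≤s p) (ℕₚ.≤-reflexive (ℕₚ.+-comm 1 (length w)))) ≤n ∷ dec

placeSmall : ∀ d n → ∃₂ λ w c → Run 1 w [ nothing ] c × length w ≡ n × holes c ≡ suc n ×
             AllPairs (Monotone d) (catMaybes c)
placeSmall true n with w , c , ρ , len , hs , _ , inc ← placeSmallIncreasing n 1 =
  w , c , ρ , len , hs , inc
placeSmall false n with w , c , ρ , len , hs , _ , dec ← placeSmallDecreasing n =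
  w , nothing ∷ c , ρ , len , cong suc hs , dec

run-stage : ∀ {n w c d} → Stage n c → Run (suc n) w c d → Stage (length w + n) d
run-stage st [] = st
run-stage {n} {w = _ ∷ w} {d = d} st (_∷_ {o = o} p ρ) =
  subst (λ k → Stage k d) (ℕₚ.+-suc (length w) n) (run-stage (plug-stage {o} p st) ρ)

-- Each slot is closed by `f`, from left to right or from right to left according to `d₂`. The last
-- component traces where the entries of `π` come from; the induction needs it to compare a new
-- leading entry with the rest.
placeLarge : ∀ t d₁ d₂ v c → t < v → All (_≤ t) (catMaybes c) → AllPairs (Monotone d₁) (catMaybes c) →
             ∃₂ λ w π → Run v w c (map just π) × AllPairs (Bimonotone t d₁ d₂) π ×
                        All (λ y → y ∈ catMaybes c ⊎ (v ≤ y × y < length w + v)) π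
placeLarge t d₁ d₂ v [] t<v small mono = [] , [] , [] , [] , []
placeLarge t d₁ d₂ v (just x ∷ c) t<v (x≤t ∷ small) (ps ∷ mono)
  with w , π , ρ , qs , src ← placeLarge t d₁ d₂ v c t<v small mono =
  w , x ∷ π , run-entry ρ , All.map related src ∷ qs ,
  inj₁ (here refl) ∷ All.map [ inj₁ ∘ there , inj₂ ]′ src
  where
  related : ∀ {y} → y ∈ catMaybes c ⊎ (v ≤ y × y < length w + v) → Bimonotone t d₁ d₂ x y
  related (inj₁ y∈)       = (λ _ _ → All.lookup ps y∈) , λ t<x → contradiction x≤t (ℕₚ.<⇒≱ t<x)
  related (inj₂ (v≤y , _)) = (λ _ y≤t → contradiction (ℕₚ.<-≤-trans t<v v≤y) (ℕₚ.≤⇒≯ y≤t)) ,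
                             λ t<x → contradiction x≤t (ℕₚ.<⇒≱ t<x)
placeLarge t d₁ true v (nothing ∷ c) t<v small mono
  with w , π , ρ , qs , src ← placeLarge t d₁ true (suc v) c (ℕₚ.m<n⇒m<1+n t<v) small mono =
  (f , 0) ∷ w , v ∷ π , _∷_ {o = f} here (run-entry ρ) , All.map related src ∷ qs ,
  inj₂ (ℕₚ.≤-refl , s≤s (ℕₚ.m≤n+m v (length w))) ∷
  All.map [ inj₁ , (λ (lo , hi) → inj₂ (ℕₚ.<⇒≤ lo , ℕₚ.<-≤-trans hi (ℕₚ.≤-reflexive (ℕₚ.+-suc (length w) v)))) ]′ src
  where
  related : ∀ {y} → y ∈ catMaybes c ⊎ (suc v ≤ y × y < length w + suc v) → Bimonotone t d₁ true v y
  related (inj₁ y∈) = (λ v≤t → contradiction t<v (ℕₚ.≤⇒≯ v≤t)) ,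
                      λ _ t<y → contradiction (All.lookup small y∈) (ℕₚ.<⇒≱ t<y)
  related (inj₂ (v<y , _)) = (λ v≤t → contradiction t<v (ℕₚ.≤⇒≯ v≤t)) , λ _ _ → v<y
placeLarge t d₁ false v (nothing ∷ c) t<v small mono
  with w , π , ρ , qs , src ← placeLarge t d₁ false v c t<v small mono =
  -- The first slot stays open while the others are filled, and so receives the largest value.
  map nextSlot w ++ [ f , 0 ] , length (map nextSlot w) + v ∷ π ,
  run-++ (run-hole ρ) (_∷_ {o = f} here []) , All.map related src ∷ qs ,
  inj₂ (ℕₚ.m≤n+m v _ , subst (length (map nextSlot w) + v <_) (sym len) ℕₚ.≤-refl) ∷
  All.map [ inj₁ , (λ (lo , hi) → inj₂ (lo , ℕₚ.<-≤-trans (ℕₚ.m<n⇒m<1+n hi) (ℕₚ.≤-reflexive (sym len′)))) ]′ src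
  where
  len : length (map nextSlot w ++ [ f , 0 ]) + v ≡ suc (length (map nextSlot w) + v)
  len = cong (_+ v) (≡.trans (Listₚ.length-++ (map nextSlot w)) (ℕₚ.+-comm _ 1))
  len′ : length (map nextSlot w ++ [ f , 0 ]) + v ≡ suc (length w + v)
  len′ = ≡.trans len (cong (λ n → suc (n + v)) (Listₚ.length-map nextSlot w))
  t<top : t < length (map nextSlot w) + v
  t<top = ℕₚ.<-≤-trans t<v (ℕₚ.m≤n+m v _)
  related : ∀ {y} → y ∈ catMaybes c ⊎ (v ≤ y × y < length w + v) →
            Bimonotone t d₁ false (length (map nextSlot w) + v) y
  related (inj₁ y∈) = (λ top≤t → contradiction t<top (ℕₚ.≤⇒≯ top≤t)) ,
                      λ _ t<y → contradiction (All.lookup small y∈) (ℕₚ.<⇒≱ t<y)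
  related (inj₂ (_ , y<)) = (λ top≤t → contradiction t<top (ℕₚ.≤⇒≯ top≤t)) ,
    λ _ _ → ℕₚ.<-≤-trans y< (ℕₚ.≤-reflexive (cong (_+ v) (sym (Listₚ.length-map nextSlot w))))

record ManySlots (L : List Letter → Set) (n : ℕ) : Set where
  field
    {prefix suffix} : List Letter
    {middle}        : Conf ℕ
    reach           : Run 1 prefix [ nothing ] middle
    slots           : holes middle ≡ suc n
    member          : L (prefix ++ suffix)

chain⇒manySlots : ∀ {k} (P : POP k) {a b c} → T (lt P a b) → T (lt P b c) →
                  ∀ n → ManySlots (EncLang P) n
chain⇒manySlots P {a} {b} {c} a<b b<c n
  with u , d , ρ , refl , hs , mono ← placeSmall ⌊ toℕ b <? toℕ a ⌋ n
  with st ← run-stage stage₀ ρ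
  -- The threshold is the number of small values; this direction opposes the pair `b`, `c`, as the
  -- earlier one opposed `a`, `b`.
  with w , π , ρ′ , ps , _ ← placeLarge (length u) _ ⌊ toℕ c <? toℕ b ⌋ (length u + 1) d
         (ℕₚ.≤-reflexive (ℕₚ.+-comm 1 _))
         (All.map (λ lt → ℕₚ.≤-trans (s≤s⁻¹ lt) (ℕₚ.≤-reflexive (ℕₚ.+-identityʳ _))) (Stage.below st)) mono
  with ρ″ ← run-++ ρ ρ′ = record
  { reach = ρ
  ; slots = hs
  ; member = π , (run-isPerm stage₀ ρ″ , avoids-chain P a<b b<c (length u) ps) , Run⇒encodes ρ″
  }

-- Unboundedly many slots exclude a finite automaton

map-split : {A B : Set} (g : A → B) (u : List B) {w : List B} (z : List A) → map g z ≡ u ++ w →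
            ∃₂ λ x y → z ≡ x ++ y × map g x ≡ u × map g y ≡ w
map-split g []      z       eq = [] , z , refl , refl , eq
map-split g (b ∷ u) (a ∷ z) eq with x , y , refl , p , q ← map-split g u z (Listₚ.∷-injectiveʳ eq) =
  a ∷ x , y , refl , cong₂ _∷_ (Listₚ.∷-injectiveˡ eq) p , q

runDFA-++ : ∀ {b} (A : DFA b) q u w → runDFA A q (u ++ w) ≡ runDFA A (runDFA A q u) w
runDFA-++ A q []      w = refl
runDFA-++ A q (a ∷ u) w = runDFA-++ A (δ A q a) u w

-- Two prefixes with different slot counts lead to the same state, so the suffix of one may follow
-- the other. That suffix would then close two different numbers of slots.
manySlots⇒¬regular : (L : List Letter → Set) →
                     (∀ {w} → L w → ∃[ π ] Run 1 w [ nothing ] (map just π)) →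
                     (∀ n → ManySlots L n) → ¬ Regular L
manySlots⇒¬regular L decodes many (b , A , rec) = ℕₚ.<⇒≢ i<j (ℕₚ.suc-injective same)
  where
  open ManySlots
  Lifts : ℕ → Set
  Lifts n = ∃₂ λ x y → map embedLetter x ≡ prefix (many n) × map embedLetter y ≡ suffix (many n) ×
                       Accepts A (x ++ y)
  lift : ∀ n → Lifts n
  lift n with z , eq , acc ← proj₁ (rec (prefix (many n) ++ suffix (many n))) (member (many n))
         with x , y , refl , p , q ← map-split embedLetter (prefix (many n)) z eq = x , y , p , q , acc
  state : ∀ n → Fin (states A)
  state n = runDFA A (start A) (proj₁ (lift n))
  -- `ℕₚ.≤-refl` sets the number of prefixes considered to one more than the number of states.
  clash : ∃₂ λ i j → toℕ i < toℕ j × state (toℕ i) ≡ state (toℕ j)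
  clash = Finₚ.pigeonhole {m = states A} ℕₚ.≤-refl (state ∘ toℕ)
  i j : ℕ
  i = toℕ (proj₁ clash)
  j = toℕ (proj₁ (proj₂ clash))
  i<j : i < j
  i<j = proj₁ (proj₂ (proj₂ clash))
  swap : (x : Lifts i) (y : Lifts j) → runDFA A (start A) (proj₁ x) ≡ runDFA A (start A) (proj₁ y) →
         L (prefix (many i) ++ suffix (many j))
  swap (x , _ , p , _ , _) (x′ , y′ , _ , q′ , acc′) eq =
    proj₂ (rec _) (x ++ y′) (≡.trans (Listₚ.map-++ embedLetter x y′) (cong₂ _++_ p q′))
      (subst (T ∘ accepting A) (≡.trans (runDFA-++ A _ x′ y′)
        (≡.trans (cong (λ s → runDFA A s y′) (sym eq)) (sym (runDFA-++ A _ x y′)))) acc′)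
  same : suc i ≡ suc j
  -- Both runs end with the same suffix and without slots, so they entered it with equally many;
  -- `reach` identifies the two counts as `suc i` and `suc j`.
  same with π , ρ ← decodes (swap (lift i) (lift j) (proj₂ (proj₂ (proj₂ clash))))
       with π′ , ρ′ ← decodes (member (many j))
       with d , ρ₁ , ρ₂ ← run-split (prefix (many i)) ρ
       with d′ , ρ₁′ , ρ₂′ ← run-split (prefix (many j)) ρ′ =
    ≡.trans (sym (slots (many i))) (≡.trans (run-holes (reach (many i)) ρ₁ refl)
      (≡.trans (run-holes⁻ ρ₂ ρ₂′ (≡.trans (holes-map-just π) (sym (holes-map-just π′))))
        (≡.trans (run-holes ρ₁′ (reach (many j)) refl) (slots (many j)))))

regular⇒bipartite : ∀ {k} (P : POP k) → RegularInsertionEncoding P → Bipartite P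
regular⇒bipartite P reg (a , b , c , a<b , b<c) =
  manySlots⇒¬regular (EncLang P) (λ (π , _ , enc) → π , encodes⇒Run enc)
    (chain⇒manySlots P a<b b<c) reg

-- Subsets of a finite universe

module Powerset {Q : Set} (_≟_ : DecidableEquality Q) (U : List Q) where

  -- Coded as a number because the states of a `DFA` form a `Fin`; `finToFun` recovers the
  -- characteristic function from the binary digits.
  Subset : Set
  Subset = Fin (2 ^ length U)

  bit : {B : Set} → Dec B → Fin 2
  bit (yes _) = fsuc fzero
  bit (no _)  = fzero

  bit⁺ : {B : Set} (d : Dec B) → B → bit d ≡ fsuc fzero
  bit⁺ (yes _) _ = refl
  bit⁺ (no ¬b) b = contradiction b ¬b

  bit⁻ : {B : Set} (d : Dec B) → bit d ≡ fsuc fzero → B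
  bit⁻ (yes b) _ = b

  bits : {B : Q → Set} → (∀ q → Dec (B q)) → Fin (length U) → Fin 2
  bits B? i = bit (B? (lookup U i))

  -- Unfolding subsets makes the terms of the automaton below explode.
  abstract

    infix 4 _∈ₛ_
    _∈ₛ_ : Q → Subset → Set
    q ∈ₛ χ = ∃[ i ] (lookup U i ≡ q × finToFun {2} χ i ≡ fsuc fzero)

    _∈ₛ?_ : ∀ q χ → Dec (q ∈ₛ χ)
    q ∈ₛ? χ = Finₚ.any? λ i → (lookup U i ≟ q) ×-dec (finToFun χ i Finₚ.≟ fsuc fzero)

    any∈? : ∀ χ {B : Q → Set} → (∀ q → Dec (B q)) → Dec (∃[ q ] (q ∈ₛ χ × B q))
    any∈? χ B? = map′ (λ (i , e , b) → lookup U i , (i , refl , e) , b)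
                      (λ { (_ , (i , refl , e) , b) → i , e , b })
                      (Finₚ.any? λ i → (finToFun χ i Finₚ.≟ fsuc fzero) ×-dec B? (lookup U i))

    collect : {B : Q → Set} → (∀ q → Dec (B q)) → Subset
    collect B? = funToFin (bits B?)

    ∈-collect⁺ : {B : Q → Set} (B? : ∀ q → Dec (B q)) → ∀ {q} → q ∈ U → B q → q ∈ₛ collect B?
    ∈-collect⁺ {B} B? {q} q∈ b = Any.index q∈ , sym (Anyₚ.lookup-index q∈) ,
      ≡.trans (Finₚ.finToFun-funToFin (bits B?) (Any.index q∈))
              (bit⁺ (B? (lookup U (Any.index q∈))) (subst B (Anyₚ.lookup-index q∈) b))

    ∈-collect⁻ : {B : Q → Set} (B? : ∀ q → Dec (B q)) → ∀ {q} → q ∈ₛ collect B? → B q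
    ∈-collect⁻ B? (i , refl , eq) =
      bit⁻ (B? (lookup U i)) (≡.trans (sym (Finₚ.finToFun-funToFin (bits B?) i)) eq)

-- Bounds that make the set of words finite

listsUpTo : {A : Set} → List A → ℕ → List (List A)
listsUpTo as zero    = [ [] ]
listsUpTo as (suc n) = [] ∷ concatMap (λ a → map (a ∷_) (listsUpTo as n)) as

∈-listsUpTo : {A : Set} {as : List A} → (∀ a → a ∈ as) → ∀ {n} xs → length xs ≤ n → xs ∈ listsUpTo as n
∈-listsUpTo all {zero}  []       _   = here refl
∈-listsUpTo all {suc n} []       _   = here refl
∈-listsUpTo all {suc n} (x ∷ xs) len = there (∈ₚ.∈-concatMap⁺ _
  (Any.map (λ { refl → ∈ₚ.∈-map⁺ (x ∷_) (∈-listsUpTo all xs (s≤s⁻¹ len)) }) (all x)))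

increasing⇒length≤ : ∀ {n} {xs : List (Fin n)} → AllPairs Fin._<_ xs → length xs ≤ n
increasing⇒length≤ {xs = xs} inc = Finₚ.injective⇒≤ {f = lookup xs} injective
  where
  injective : ∀ {i j} → lookup xs i ≡ lookup xs j → i ≡ j
  injective {i} {j} eq with Finₚ.<-cmp i j
  ... | tri< i<j _ _ = contradiction eq (Finₚ.<⇒≢ (lookup-AllPairs inc i j i<j))
  ... | tri≈ _ i≡j _ = i≡j
  ... | tri> _ _ j<i = contradiction (sym eq) (Finₚ.<⇒≢ (lookup-AllPairs inc j i j<i))

-- Slots correspond one to one, whereas entries of the configuration may be skipped: a word retains
-- all open slots but only the entries used by the partial occurrence.
data Match {A B : Set} (R : A → B → Set) : Conf A → Conf B → Set where
  []   : Match R [] []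
  hole : ∀ {s c} → Match R s c → Match R (nothing ∷ s) (nothing ∷ c)
  skip : ∀ {s x c} → Match R s c → Match R s (just x ∷ c)
  keep : ∀ {a s x c} → R a x → Match R s c → Match R (just a ∷ s) (just x ∷ c)

module _ {A B : Set} {R : A → B → Set} where

  match-holes : ∀ {s c} → Match R s c → holes s ≡ holes c
  match-holes []         = refl
  match-holes (hole μ)   = cong suc (match-holes μ)
  match-holes (skip μ)   = match-holes μ
  match-holes (keep _ μ) = match-holes μ

  match-mono : ∀ {R′ : A → B → Set} {s c} → (∀ {a x} → a ∈ catMaybes s → R a x → R′ a x) →
               Match R s c → Match R′ s c
  match-mono h []         = []
  match-mono h (hole μ)   = hole (match-mono h μ)
  match-mono h (skip μ)   = skip (match-mono h μ)
  match-mono h (keep p μ) = keep (h (here refl) p) (match-mono (h ∘ there) μ)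

  match-plug : ∀ {o e v i s s′ c c′} → Match R s c → Plug (frame o e) i s s′ →
               Plug (frame o (just v)) i c c′ → MaybeAll.All (λ a → R a v) e → Match R s′ c′
  match-plug {f} (hole μ) here here nothing  = skip μ
  match-plug {l} (hole μ) here here nothing  = skip (hole μ)
  match-plug {r} (hole μ) here here nothing  = hole (skip μ)
  match-plug {m} (hole μ) here here nothing  = hole (skip (hole μ))
  match-plug {f} (hole μ) here here (just x) = keep x μ
  match-plug {l} (hole μ) here here (just x) = keep x (hole μ)
  match-plug {r} (hole μ) here here (just x) = hole (keep x μ)
  match-plug {m} (hole μ) here here (just x) = hole (keep x (hole μ))
  match-plug {o} (hole μ) (hole p) (hole q) x = hole (match-plug {o} μ p q x)
  match-plug {o} (skip μ) p (entry q) x = skip (match-plug {o} μ p q x)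
  match-plug {o} (keep y μ) (entry p) (entry q) x = keep y (match-plug {o} μ p q x)

  -- Whether the match skips or keeps the new value determines `e`. Together with `match-plug`, this
  -- lets words follow configurations move by move in both directions.
  match-unplug : ∀ {o v i s′ c c′} → Plug (frame o (just v)) i c c′ → Match R s′ c′ →
                 ∃₂ λ s e → Plug (frame o e) i s s′ × Match R s c × MaybeAll.All (λ a → R a v) e
  match-unplug {f} here (skip μ)               = _ , nothing , here , hole μ , nothing
  match-unplug {l} here (skip (hole μ))        = _ , nothing , here , hole μ , nothing
  match-unplug {r} here (hole (skip μ))        = _ , nothing , here , hole μ , nothing
  match-unplug {m} here (hole (skip (hole μ))) = _ , nothing , here , hole μ , nothing
  match-unplug {f} here (keep x μ)               = _ , just _ , here , hole μ , just x
  match-unplug {l} here (keep x (hole μ))        = _ , just _ , here , hole μ , just x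
  match-unplug {r} here (hole (keep x μ))        = _ , just _ , here , hole μ , just x
  match-unplug {m} here (hole (keep x (hole μ))) = _ , just _ , here , hole μ , just x
  match-unplug {o} (hole p) (hole μ) with s , e , q , μ′ , x ← match-unplug {o} p μ =
    _ , e , hole q , hole μ′ , x
  match-unplug {o} (entry p) (skip μ) with s , e , q , μ′ , x ← match-unplug {o} p μ =
    _ , e , q , skip μ′ , x
  match-unplug {o} (entry p) (keep y μ) with s , e , q , μ′ , x ← match-unplug {o} p μ =
    _ , e , entry q , keep y μ′ , x

  match⇒sublist : ∀ as {bs} → Match R (map just as) (map just bs) → Sublist R as bs
  match⇒sublist []       {[]}     []         = []
  match⇒sublist as       {b ∷ bs} (skip μ)   = b ∷ʳ match⇒sublist as μ
  match⇒sublist (a ∷ as) {b ∷ bs} (keep x μ) = x ∷ match⇒sublist as μ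

  sublist⇒match : ∀ {as bs} → Sublist R as bs → Match R (map just as) (map just bs)
  sublist⇒match []       = []
  sublist⇒match (_ ∷ʳ σ) = skip (sublist⇒match σ)
  sublist⇒match (x ∷ σ)  = keep x (sublist⇒match σ)

match-values : {A B : Set} {ν : A → B} {B′ : B → Set} {s : Conf A} {c : Conf B} →
               Match (λ a x → ν a ≡ x) s c → All B′ (catMaybes c) → All (B′ ∘ ν) (catMaybes s)
match-values []            _        = []
match-values (hole μ)      ps       = match-values μ ps
match-values (skip μ)      (_ ∷ ps) = match-values μ ps
match-values (keep refl μ) (p ∷ ps) = p ∷ match-values μ ps

-- Occurrences as increasing positions and as sublists

Increasing : ∀ {k n} → (Fin k → Fin n) → Set
Increasing ι = ∀ a b → toℕ a < toℕ b → toℕ (ι a) < toℕ (ι b)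

sublist⇒positions : {A B : Set} {R : A → B → Set} → ∀ {k} {g : Fin k → A} {xs : List B} →
                    Sublist R (tabulate g) xs →
                    Σ (Fin k → Fin (length xs)) λ ι → Increasing ι × (∀ j → R (g j) (lookup xs (ι j)))
sublist⇒positions {k = zero} _ = (λ ()) , (λ ()) , λ ()
sublist⇒positions {k = suc k} (_ ∷ʳ σ) with ι , mono , rel ← sublist⇒positions {k = suc k} σ =
  fsuc ∘ ι , (λ a b lt → s≤s (mono a b lt)) , rel
sublist⇒positions {k = suc k} (x ∷ σ) with ι , mono , rel ← sublist⇒positions σ =
  (λ { fzero → fzero ; (fsuc a) → fsuc (ι a) }) ,
  (λ { fzero (fsuc b) _ → z<s ; (fsuc a) (fsuc b) lt → s≤s (mono a b (s≤s⁻¹ lt)) }) ,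
  λ { fzero → x ; (fsuc j) → rel j }

lowerPositions : ∀ {k n} (ι : Fin k → Fin (suc n)) → (∀ a → 0 < toℕ (ι a)) →
                 Σ (Fin k → Fin n) λ κ → ∀ a → ι a ≡ fsuc (κ a)
lowerPositions ι pos = (λ a → proj₁ (lower (ι a) (pos a))) , λ a → proj₂ (lower (ι a) (pos a))
  where
  lower : ∀ {n} (i : Fin (suc n)) → 0 < toℕ i → ∃[ j ] i ≡ fsuc j
  lower (fsuc j) _ = j , refl

positions⇒sublist : {A B : Set} {R : A → B → Set} → ∀ k (g : Fin k → A) (xs : List B)
                    (ι : Fin k → Fin (length xs)) → Increasing ι →
                    (∀ j → R (g j) (lookup xs (ι j))) → Sublist R (tabulate g) xs
positions⇒sublist zero g [] ι mono rel = []
positions⇒sublist zero g (x ∷ xs) ι mono rel = x ∷ʳ positions⇒sublist zero g xs (λ ()) (λ ()) λ ()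
positions⇒sublist (suc k) g [] ι mono rel with () ← ι fzero
positions⇒sublist {R = R} (suc k) g (x ∷ xs) ι mono rel with ι fzero in eq
... | fzero = subst (λ i → R (g fzero) (lookup (x ∷ xs) i)) eq (rel fzero) ∷
  positions⇒sublist k (g ∘ fsuc) xs κ
    (λ a b lt → s≤s⁻¹ (≡.subst₂ (λ i j → toℕ i < toℕ j) (ικ a) (ικ b) (mono (fsuc a) (fsuc b) (s≤s lt))))
    λ j → subst (λ i → R (g (fsuc j)) (lookup (x ∷ xs) i)) (ικ j) (rel (fsuc j))
  where
  lowered = lowerPositions (ι ∘ fsuc) λ a →
    subst (λ i → toℕ i < toℕ (ι (fsuc a))) eq (mono fzero (fsuc a) z<s)
  κ = proj₁ lowered
  ικ = proj₂ lowered
... | fsuc i = x ∷ʳ positions⇒sublist (suc k) g xs κ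
    (λ a b lt → s≤s⁻¹ (≡.subst₂ (λ i j → toℕ i < toℕ j) (ικ a) (ικ b) (mono a b lt)))
    λ j → subst (λ i → R (g j) (lookup (x ∷ xs) i)) (ικ j) (rel j)
  where
  positive : ∀ a → 0 < toℕ (ι a)
  positive fzero rewrite eq = z<s
  positive (fsuc a) = ℕₚ.≤-<-trans z≤n (mono fzero (fsuc a) z<s)
  lowered = lowerPositions ι positive
  κ = proj₁ lowered
  ικ = proj₂ lowered

-- Partial occurrences

AllPairs-remove : {A : Set} {R : A → A → Set} (xs : List A) {y : A} {zs : List A} →
                  AllPairs R (xs ++ y ∷ zs) →
                  AllPairs R (xs ++ zs) × All (λ x → R x y ⊎ R y x) (xs ++ zs)
AllPairs-remove []       (ps ∷ qs) = qs , All.map inj₂ ps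
AllPairs-remove (x ∷ xs) (ps ∷ qs) with rs , ts ← AllPairs-remove xs qs
                                   with as , b ∷ bs ← Allₚ.++⁻ xs ps =
  Allₚ.++⁺ as bs ∷ rs , inj₁ b ∷ ts

plug-increasing⁻ : ∀ {k o i s s′} {e : Maybe (Fin k)} → Plug (frame o e) i s s′ →
                   AllPairs Fin._<_ (catMaybes s′) → AllPairs Fin._<_ (catMaybes s)
plug-increasing⁻ {o = o} {e = nothing} p inc = subst (AllPairs Fin._<_) (plug-entries-≡ {o = o} p) inc
plug-increasing⁻ {o = o} {e = just j} p inc with xs , ys , eq , eq′ ← plug-entries {o = o} p
  rewrite eq | eq′ = proj₁ (AllPairs-remove xs inc)

-- No element is placed twice: strict increase compares `j` strictly with every other entry.
plug-increasing-∉ : ∀ {k o i s s′} {j : Fin k} → Plug (frame o (just j)) i s s′ →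
                    AllPairs Fin._<_ (catMaybes s′) → j ∉ catMaybes s
plug-increasing-∉ {o = o} {j = j} p inc j∈ with xs , ys , eq , eq′ ← plug-entries {o = o} p
  rewrite eq | eq′ =
  [ Finₚ.<-irrefl refl , Finₚ.<-irrefl refl ]′ (All.lookup (proj₂ (AllPairs-remove xs inc)) j∈)

module _ {k : ℕ} (P : POP k) where

  -- A word records the elements of P already placed and the open slots
  -- between them.  The bound on the slots keeps the set of words finite.

  Word : Set
  Word = Conf (Fin k)

  -- The placed elements form a down-set of `P`, because values arrive in increasing order and an
  -- element must wait for everything below it.
  Closed : Word → Set
  Closed s = ∀ a b → T (lt P a b) → b ∈ catMaybes s → a ∈ catMaybes s

  Valid : Word → Set
  Valid s = holes s ≤ suc k × AllPairs Fin._<_ (catMaybes s) × Closed s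

  valid? : ∀ s → Dec (Valid s)
  valid? s = (holes s ≤? suc k) ×-dec AllPairs.allPairs? Finₚ._<?_ (catMaybes s) ×-dec
    Finₚ.all? λ a → Finₚ.all? λ b →
      T? (lt P a b) →-dec (mem? Finₚ._≟_ b (catMaybes s) →-dec mem? Finₚ._≟_ a (catMaybes s))

  _≟ʷ_ : DecidableEquality Word
  _≟ʷ_ = Listₚ.≡-dec (Maybeₚ.≡-dec Finₚ._≟_)

  -- A nondeterministic move: the inserted value is ignored or takes the role of one element, whose
  -- position and timing are controlled by the validity of `s′`. No numerical values enter, so
  -- finitely many words suffice.
  Step : Word → Letter → Word → Set
  Step s (o , i) s′ = Valid s′ × ∃[ e ] Plug (frame o e) i s s′

  step? : ∀ s x s′ → Dec (Step s x s′)
  step? s (o , i) s′ = valid? s′ ×-dec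
    map′ [ (nothing ,_) , (λ (j , p) → just j , p) ]′
         (λ { (nothing , p) → inj₁ p ; (just j , p) → inj₂ (j , p) })
         (plug? _≟ʷ_ (frame o nothing) i s s′ ⊎-dec
          Finₚ.any? λ j → plug? _≟ʷ_ (frame o (just j)) i s s′)

  Respects : (Fin k → ℕ) → Word → Set
  Respects ν s = ∀ a b → T (lt P a b) → b ∈ catMaybes s → ν a < ν b

  Occurs : Word → Conf ℕ → Set
  Occurs s c = Valid s × ∃[ ν ] (Match (λ a x → ν a ≡ x) s c × Respects ν s)

  occurs-holes : ∀ {s c} → Occurs s c → holes s ≡ holes c
  occurs-holes (_ , _ , μ , _) = match-holes μ

  -- The new value exceeds all placed ones, so the element taking it lies above whatever it must.
  -- Nothing that should lie above it is present yet, since the old word is closed.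
  occurs-plug : ∀ {o v i s s′ c c′} → All (_< v) (catMaybes c) → Plug (frame o (just v)) i c c′ →
                Step s (o , i) s′ → Occurs s c → Occurs s′ c′
  occurs-plug {o} below q (valid , nothing , p) (_ , ν , μ , resp) =
    valid , ν , match-plug {o = o} μ p q nothing ,
    λ a b a<b b∈ → resp a b a<b (subst (b ∈_) (plug-entries-≡ {o = o} p) b∈)
  occurs-plug {o} {v} {s = s} {s′} {c} below q (valid@(_ , inc , closed′) , just j , p) ((_ , _ , closed) , ν , μ , resp) =
    valid , ν′ , match-plug {o = o} (match-mono (λ a∈ eq → ≡.trans (ν′-old a∈) eq) μ) p q (just ν′-new) , resp′
    where
    ν′ : Fin k → ℕ
    ν′ a with a Finₚ.≟ j
    ... | yes _ = v
    ... | no _  = ν a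
    ν′-new : ν′ j ≡ v
    ν′-new with j Finₚ.≟ j
    ... | yes _  = refl
    ... | no neq = contradiction refl neq
    ν′-old : ∀ {a} → a ∈ catMaybes s → ν′ a ≡ ν a
    ν′-old {a} a∈ with a Finₚ.≟ j
    ... | yes refl = contradiction a∈ (plug-increasing-∉ {o = o} p inc)
    ... | no _     = refl
    old-or-new : ∀ {a} → a ∈ catMaybes s′ → a ≡ j ⊎ a ∈ catMaybes s
    old-or-new a∈ with ↭ₚ.∈-resp-↭ (plug-entries-↭ {o = o} p) a∈
    ... | here eq  = inj₁ eq
    ... | there a∈s = inj₂ a∈s
    resp′ : Respects ν′ s′
    resp′ a b a<b b∈ with old-or-new b∈ | old-or-new (closed′ a b a<b b∈)
    ... | inj₁ refl | inj₁ refl = contradiction refl (lt⇒≢ P a<b)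
    ... | inj₁ refl | inj₂ a∈s  rewrite ν′-old a∈s | ν′-new = All.lookup (match-values μ below) a∈s
    ... | inj₂ b∈s  | _ rewrite ν′-old b∈s | ν′-old (closed a b a<b b∈s) = resp a b a<b b∈s

  -- Removing the newest element keeps the word closed: an element above it would have a value
  -- greater than `v`, while all remaining values are below `v`.
  occurs-unplug : ∀ {o v i s′ c c′} → All (_< v) (catMaybes c) → holes c ≤ suc k →
                  Plug (frame o (just v)) i c c′ → Occurs s′ c′ →
                  ∃[ s ] (Occurs s c × Step s (o , i) s′)
  occurs-unplug {o} {v} {s′ = s′} below few q (valid@(_ , inc , closed′) , ν , μ , resp)
    with s , e , p , μ′ , fits ← match-unplug {o = o} q μ =
    s , ((subst (_≤ suc k) (sym (match-holes μ′)) few , plug-increasing⁻ {o = o} p inc , closed) ,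
         ν , μ′ , λ a b a<b b∈ → resp a b a<b (old∈ e p b∈)) ,
    valid , e , p
    where
    old∈ : ∀ {s s′ i a} e → Plug (frame o e) i s s′ → a ∈ catMaybes s → a ∈ catMaybes s′
    old∈ nothing  p = subst (_ ∈_) (sym (plug-entries-≡ {o = o} p))
    old∈ (just j) p = ↭ₚ.∈-resp-↭ (↭-sym (plug-entries-↭ {o = o} p)) ∘ there
    closed : Closed s
    closed a b a<b b∈ = back e p fits (closed′ a b a<b (old∈ e p b∈))
      where
      back : ∀ e → Plug (frame o e) _ s s′ → MaybeAll.All (λ a → ν a ≡ v) e →
             a ∈ catMaybes s′ → a ∈ catMaybes s
      back nothing  p _ a∈ = subst (a ∈_) (plug-entries-≡ {o = o} p) a∈
      back (just j) p (just νj≡v) a∈ with ↭ₚ.∈-resp-↭ (plug-entries-↭ {o = o} p) a∈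
      ... | there a∈s = a∈s
      ... | here refl = contradiction (resp a b a<b (old∈ (just j) p b∈))
        (ℕₚ.<⇒≯ (ℕₚ.<-≤-trans (All.lookup (match-values μ′ below) b∈) (ℕₚ.≤-reflexive (sym νj≡v))))

  full : Word
  full = map just (allFin k)

  entries-full : catMaybes full ≡ allFin k
  entries-full = catMaybes-map-just (allFin k)

  full-valid : Valid full
  full-valid = ℕₚ.≤-trans (ℕₚ.≤-reflexive (holes-map-just (allFin k))) z≤n ,
    subst (AllPairs Fin._<_) (sym entries-full) (AllPairsₚ.tabulate⁺-< id) ,
    λ a b _ _ → subst (a ∈_) (sym entries-full) (∈ₚ.∈-allFin a)

  occurs-full⇒contains : ∀ {π} → Occurs full (map just π) → Contains π P
  occurs-full⇒contains (_ , ν , μ , resp)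
    with ι , mono , eq ← sublist⇒positions (match⇒sublist (allFin k) μ) =
    ι , mono , λ a b a<b →
      ≡.subst₂ _<_ (eq a) (eq b) (resp a b a<b (subst (b ∈_) (sym entries-full) (∈ₚ.∈-allFin b)))

  contains⇒occurs-full : ∀ {π} → Contains π P → Occurs full (map just π)
  contains⇒occurs-full {π} (ι , mono , vals) = full-valid , lookup π ∘ ι ,
    sublist⇒match (positions⇒sublist k id π ι mono λ _ → refl) , λ a b a<b _ → vals a b a<b

  -- In a bipartite P let the non-maximal elements take values placed before
  -- step v, and the others values placed from step v on.

  HasAbove : Fin k → Set
  HasAbove a = ∃[ b ] T (lt P a b)

  hasAbove? : ∀ a → Dec (HasAbove a)
  hasAbove? a = Finₚ.any? λ b → T? (lt P a b)

  data Fits (v : ℕ) (a : Fin k) : Maybe ℕ → Set where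
    low  : ∀ {x} → HasAbove a → x < v → Fits v a (just x)
    high : ∀ {x} → ¬ HasAbove a → v ≤ x → Fits v a (just x)
    open-slot : ¬ HasAbove a → Fits v a nothing

  -- Greedy from the left: each element uses up one slot and the entry behind it, taking the slot if
  -- it is maximal and the entry otherwise. The strict inequality allows for a final slot with no
  -- entry behind it.
  many-slots⇒fits : ∀ {v c} → Alternating c → All (_< v) (catMaybes c) →
                    ∀ as → length as < holes c → Sublist (Fits v) as c
  many-slots⇒fits alt below [] _ = minimum _
  many-slots⇒fits (entry alt) (_ ∷ below) as@(_ ∷ _) len = _ ∷ʳ many-slots⇒fits alt below as len
  many-slots⇒fits last below (_ ∷ _) (s≤s ())
  many-slots⇒fits (hole alt) (x<v ∷ below) (a ∷ as) len with hasAbove? a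
  ... | yes above = nothing ∷ʳ (low above x<v ∷ many-slots⇒fits alt below as (s≤s⁻¹ len))
  ... | no ¬above = open-slot ¬above ∷ (_ ∷ʳ many-slots⇒fits alt below as (s≤s⁻¹ len))

  frame-fits : ∀ o {v u a as c} → Fits v a nothing → v ≤ u →
               Sublist (Fits v) as c → Sublist (Fits v) (a ∷ as) (frame o (just u) ++ c)
  frame-fits f (open-slot ¬above) v≤u σ = high ¬above v≤u ∷ σ
  frame-fits l (open-slot ¬above) v≤u σ = high ¬above v≤u ∷ (nothing ∷ʳ σ)
  frame-fits r (open-slot ¬above) v≤u σ = nothing ∷ʳ (high ¬above v≤u ∷ σ)
  frame-fits m (open-slot ¬above) v≤u σ = nothing ∷ʳ (high ¬above v≤u ∷ (nothing ∷ʳ σ))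

  -- An element waiting in a slot moves to the value that fills the slot, which is at least `v`.
  plug-fits : ∀ {o v u i as c d} → Plug (frame o (just u)) i c d → v ≤ u →
              Sublist (Fits v) as c → Sublist (Fits v) as d
  plug-fits {o} here      v≤u (_ ∷ʳ σ) = Sublistₚ.++ˡ (frame o _) σ
  plug-fits {o} here      v≤u (x ∷ σ)  = frame-fits o x v≤u σ
  plug-fits {o} (hole p)  v≤u (y ∷ʳ σ) = y ∷ʳ plug-fits {o} p v≤u σ
  plug-fits {o} (hole p)  v≤u (x ∷ σ)  = x ∷ plug-fits {o} p v≤u σ
  plug-fits {o} (entry p) v≤u (y ∷ʳ σ) = y ∷ʳ plug-fits {o} p v≤u σ
  plug-fits {o} (entry p) v≤u (x ∷ σ)  = x ∷ plug-fits {o} p v≤u σ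

  run-fits : ∀ {v u w as c d} → Run u w c d → v ≤ u → Sublist (Fits v) as c → Sublist (Fits v) as d
  run-fits [] v≤u σ = σ
  run-fits (_∷_ {o = o} p ρ) v≤u σ = run-fits ρ (ℕₚ.m≤n⇒m≤1+n v≤u) (plug-fits {o = o} p v≤u σ)

  fits-entries : ∀ {v as} π → Sublist (Fits v) as (map just π) →
                 Sublist (λ a x → Fits v a (just x)) as π
  fits-entries []      []       = []
  fits-entries (x ∷ π) (_ ∷ʳ σ) = x ∷ʳ fits-entries π σ
  fits-entries (x ∷ π) (y ∷ σ)  = y ∷ fits-entries π σ

  many-slots⇒contains : Bipartite P → ∀ {n w c π} → Stage n c → k < holes c →
                        Run (suc n) w c (map just π) → Contains π P
  many-slots⇒contains bip {π = π} st many ρ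
    with ι , mono , fits ← sublist⇒positions (fits-entries π (run-fits ρ ℕₚ.≤-refl
           (many-slots⇒fits (Stage.alternating st) (Stage.below st) (allFin k)
             (subst (_< _) (sym (Listₚ.length-tabulate id)) many)))) =
    ι , mono , λ a b a<b → split a<b (fits a) (fits b)
    where
    split : ∀ {v a b x y} → T (lt P a b) → Fits v a (just x) → Fits v b (just y) → x < y
    split a<b (high ¬above _) _ = contradiction (_ , a<b) ¬above
    -- Here `b` would be the middle of a chain.
    split a<b (low _ _) (low (c , b<c) _) = contradiction (_ , _ , _ , a<b , b<c) bip
    split a<b (low _ x<v) (high _ v≤y) = ℕₚ.<-≤-trans x<v v≤y

  -- The automaton and its correctness

  universe : List Word
  -- At most `suc k` slots and at most `k` elements.
  universe = listsUpTo (nothing ∷ map just (allFin k)) (suc k + k)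

  valid⇒∈universe : ∀ {s} → Valid s → s ∈ universe
  valid⇒∈universe {s} (few , inc , _) = ∈-listsUpTo
    (λ { nothing → here refl ; (just a) → there (∈ₚ.∈-map⁺ just (∈ₚ.∈-allFin a)) }) s
    (ℕₚ.≤-trans (ℕₚ.≤-reflexive (length≡holes+entries s)) (ℕₚ.+-mono-≤ few (increasing⇒length≤ inc)))

  open Powerset _≟ʷ_ universe

  successor? : ∀ χ x s′ → Dec (∃[ s ] (s ∈ₛ χ × Step s x s′))
  successor? χ x s′ = any∈? χ λ s → step? s x s′

  -- The empty word occurs exactly when no slot is open, and `full` occurs exactly when the
  -- permutation contains `P`.
  final? : ∀ χ → Dec ([] ∈ₛ χ × ¬ (full ∈ₛ χ))
  final? χ = ([] ∈ₛ? χ) ×-dec ¬? (full ∈ₛ? χ)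

  -- The subset construction applied to `Step`.
  automaton : DFA (suc k)
  automaton = record
    { states    = 2 ^ length universe
    ; start     = collect (_≟ʷ [ nothing ])
    ; accepting = λ χ → ⌊ final? χ ⌋
    ; δ         = λ χ x → collect (successor? χ (embedLetter x))
    }

  Represents : Subset → Conf ℕ → Set
  Represents χ c = ∀ s → (s ∈ₛ χ → Occurs s c) × (Occurs s c → s ∈ₛ χ)

  represents-start : Represents (start automaton) [ nothing ]
  represents-start s = (λ s∈ → to s (∈-collect⁻ (_≟ʷ [ nothing ]) s∈)) ,
    λ { (valid , _ , hole [] , _) → ∈-collect⁺ (_≟ʷ [ nothing ]) (valid⇒∈universe valid) refl }
    where
    to : ∀ s → s ≡ [ nothing ] → Occurs s [ nothing ]
    to _ refl = (s≤s z≤n , [] , λ _ _ _ ()) , (λ _ → 0) , hole [] , λ _ _ _ ()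

  -- The bound on `c` serves `occurs-unplug`. None is imposed on `d`: if it has too many slots, no
  -- word occurs in it and the new state is the empty set.
  represents-δ : ∀ {n χ c d o} {i : Fin (suc k)} → Stage n c → holes c ≤ suc k →
                 Plug (frame o (just (suc n))) (toℕ i) c d →
                 Represents χ c → Represents (δ automaton χ (o , i)) d
  represents-δ {χ = χ} {o = o} {i} st few p rep s′ =
    (λ s′∈ → let s , s∈ , st′ = ∈-collect⁻ (successor? χ (o , toℕ i)) s′∈
             in occurs-plug {o} (Stage.below st) p st′ (proj₁ (rep s) s∈)) ,
    λ occ → let s , occ′ , st′ = occurs-unplug {o} (Stage.below st) few p occ
            in ∈-collect⁺ (successor? χ (o , toℕ i)) (valid⇒∈universe (proj₁ occ))
                 (s , proj₂ (rep s) occ′ , st′)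

  Accepts-from : Subset → List (Op × Fin (suc k)) → Set
  Accepts-from χ w = T (accepting automaton (runDFA automaton χ w))

  -- The empty set is a rejecting sink, entered when a letter names a missing slot or when more than
  -- `suc k` slots are open.
  empty⇒¬accepts : ∀ χ w → (∀ s → ¬ (s ∈ₛ χ)) → ¬ Accepts-from χ w
  empty⇒¬accepts χ [] empty acc = empty _ (proj₁ (toWitness acc))
  empty⇒¬accepts χ (x ∷ w) empty = empty⇒¬accepts _ w λ s s∈ →
    let s₀ , s₀∈ , _ = ∈-collect⁻ (successor? χ (embedLetter x)) s∈ in empty s₀ s₀∈

  match-[] : ∀ {R : Fin k → ℕ → Set} {c} → Match R [] c → ∃[ π ] c ≡ map just π
  match-[] []       = [] , refl
  match-[] (skip μ) with π , refl ← match-[] μ = _ ∷ π , refl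

  accepts⇒avoider : ∀ {n χ c} w → Stage n c → holes c ≤ suc k → Represents χ c → Accepts-from χ w →
                    ∃[ π ] (Run (suc n) (map embedLetter w) c (map just π) × Avoids π P)
  accepts⇒avoider [] st few rep acc
    with []∈ , full∉ ← toWitness acc
    with _ , _ , μ , _ ← proj₁ (rep []) []∈
    with π , refl ← match-[] μ = π , [] , full∉ ∘ proj₂ (rep full) ∘ contains⇒occurs-full
  accepts⇒avoider {n} {χ} {c} ((o , i) ∷ w) st few rep acc with toℕ i <? holes c
  ... | no i≮ = ⊥-elim (empty⇒¬accepts _ w
    (λ s′ s′∈ → let s , s∈ , (_ , _ , p) = ∈-collect⁻ (successor? χ (o , toℕ i)) s′∈
                in i≮ (subst (toℕ i <_) (occurs-holes (proj₁ (rep s) s∈)) (plug-< p))) acc)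
  ... | yes i< with d , p ← plug (frame o (just (suc n))) c i<
               with rep′ ← represents-δ {o = o} {i} st few p rep
               with holes d ≤? suc k
  ...   | yes few′ = let π , ρ , avoids = accepts⇒avoider w (plug-stage {o} p st) few′ rep′ acc
                     in π , _∷_ {o = o} p ρ , avoids
  ...   | no many = ⊥-elim (empty⇒¬accepts _ w
    (λ s s∈ → let occ@((few′ , _) , _) = proj₁ (rep′ s) s∈
              in many (subst (_≤ suc k) (occurs-holes occ) few′)) acc)

  <⇒toℕ : ∀ {i n} → i < n → ∃[ j ] i ≡ toℕ {n} j
  <⇒toℕ i<n = fromℕ< i<n , sym (Finₚ.toℕ-fromℕ< i<n)

  avoider⇒accepts : Bipartite P → ∀ {n χ c w π} → Stage n c → holes c ≤ suc k → Represents χ c →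
                    Run (suc n) w c (map just π) → Avoids π P →
                    ∃[ w′ ] (map embedLetter w′ ≡ w × Accepts-from χ w′)
  avoider⇒accepts bip {χ = χ} {π = π} st few rep [] avoids = [] , refl , fromWitness
    ( proj₂ (rep []) ((z≤n , [] , λ _ _ _ ()) , (λ _ → 0) , nothing-left π , λ _ _ _ ())
    , avoids ∘ occurs-full⇒contains ∘ proj₁ (rep full) )
    where
    nothing-left : ∀ π → Match (λ (a : Fin k) x → 0 ≡ x) [] (map just π)
    nothing-left []      = []
    nothing-left (_ ∷ π) = skip (nothing-left π)
  avoider⇒accepts bip {n} {χ} {c} {(o , i) ∷ w} st few rep (_∷_ {d = d} p ρ) avoids
    with holes d ≤? suc k
  ... | no many = contradiction
    (many-slots⇒contains bip (plug-stage {o} p st) (ℕₚ.<-trans ℕₚ.≤-refl (ℕₚ.≰⇒> many)) ρ) avoids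
  ... | yes few′
    -- The letter names an existing slot, and there are at most `suc k` of them, so it belongs to
    -- the alphabet.
    with j , refl ← <⇒toℕ (ℕₚ.<-≤-trans (plug-< p) few)
    with w′ , eq , acc ← avoider⇒accepts bip (plug-stage {o} p st) few′
                           (represents-δ {o = o} {j} st few p rep) ρ avoids =
    (o , j) ∷ w′ , cong (_ ∷_) eq , acc

  bipartite⇒regular : Bipartite P → RegularInsertionEncoding P
  bipartite⇒regular bip = suc k , automaton , λ w →
    (λ (π , (_ , avoids) , enc) →
      avoider⇒accepts bip stage₀ (s≤s z≤n) represents-start (encodes⇒Run enc) avoids) ,
    λ { w′ refl acc → let π , ρ , avoids = accepts⇒avoider w′ stage₀ (s≤s z≤n) represents-start acc
                      in π , (run-isPerm stage₀ ρ , avoids) , Run⇒encodes ρ }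

theorem2 : ∀ (k : ℕ) (P : POP k) →
    (RegularInsertionEncoding P → Bipartite P) × (Bipartite P → RegularInsertionEncoding P)
theorem2 k P = regular⇒bipartite P , bipartite⇒regular P
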